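{- Let $G$ be a sub-$2$-permutable graph and let $H$ be a $2$-adjustable graph. Then $\chi_i(G\,\square\,H)\le \Delta(G\,\square\,H)+2$.
   Context: All graphs are finite and simple. $K^-_{2n}$ is the complete graph on $2n$ vertices with a perfect matching removed. A homomorphism $f:G\to H$ is a map $V(G)\to V(H)$ with $f(u)f(v)\in E(H)$ whenever $uv\in E(G)$; it is locally injective if for every vertex $v$, $f$ is injective on $N(v)$. A graph $G$ is sub-$2$-permutable if it admits a locally injective homomorphism to $K^-_{\Delta(G)+2}$. An incidence of $G$ is a pair $(v,e)$ with $v\in e\in E(G)$; incidences $(v,e),(u,f)$ are adjacent if $v=u$, or $e=f$, or $vu\in\{e,f\}$; an incidence coloring gives adjacent incidences distinct colors; $\chi_i(G)$ is the least number of colors of an incidence coloring. $S^0_c(v)=\{c(v,uv):uv\in E(G)\}$. An incidence coloring $c$ with palette $P$ is adjustable if there are two distinct colors $x,y\in P$ such that no vertex $v$ has $\{x,y\}\subseteq S^0_c(v)$; $H$ is $2$-adjustable if it admits an adjustable incidence coloring with a palette of size $\Delta(H)+2$. $\Delta$ denotes maximum degree. $G\,\square\,H$ is the Cartesian product: vertex set $V(G)\times V(H)$, $(u,v)\sim(u',v')$ iff ($uu'\in E(G)$, $v=v'$) or ($u=u'$, $vv'\in E(H)$). -}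

module Defs where

open import Data.Fin using (Fin; finToFun; funToFin) renaming (_<_ to _<ᶠ_)
import Data.Fin.Properties as Fin
open import Data.List using (List; _∷_; map; filter; length; allFin; cartesianProduct; mapMaybe; lookup)
open import Data.List.Extrema.Nat using (max)
open import Data.List.Membership.Propositional using (_∈_)
open import Data.List.Membership.Propositional.Properties using (∈-map⁺; ∈-allFin; ∈-cartesianProduct⁺)
open import Data.List.Relation.Unary.Any using (here; there; index)
open import Data.List.Relation.Unary.Any.Properties using (lookup-index)
open import Data.Maybe using (Maybe; just; nothing)
open import Data.Nat using (ℕ; zero; suc; _+_; _*_; _≤_; z≤n; s≤s)
open import Data.Product using (Σ; ∃-syntax; _×_; _,_; proj₁; proj₂)
open import Data.Product.Function.NonDependent.Propositional using (_×-↔_)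
open import Data.Product.Properties using (≡-dec)
open import Data.Sum using (_⊎_; inj₁; inj₂)
open import Function using (_∘_; _↔_; Inverse)
open import Function.Construct.Composition using (_↔-∘_)
open import Function.Construct.Symmetry using (↔-sym)
open import Function.Properties.Inverse using (↔⇒↣)
open import Relation.Binary using (Decidable; DecidableEquality; Symmetric)
open import Relation.Binary.PropositionalEquality using (_≡_; _≢_; refl; sym; trans; cong; subst)
open import Relation.Nullary using (¬_; Dec; yes; no; contradiction)
open import Relation.Nullary.Decidable using (map′; via-injection; _×-dec_; _⊎-dec_; _→-dec_; ¬?; recompute)

record Graph : Set₁ where
  infix 4 _~_ _~?_ _≟_
  field
    V      : Set
    order  : ℕ
    finite : V ↔ Fin order
    _~_    : V → V → Set
    _~?_   : Decidable _~_
    ~-sym  : Symmetric _~_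
    ~-irr  : ∀ v → ¬ (v ~ v)

  open Inverse finite public using () renaming (to to rank; from to unrank)

  _≟_ : DecidableEquality V
  _≟_ = via-injection (↔⇒↣ finite) Fin._≟_

  vertices : List V
  vertices = map unrank (allFin order)

  deg : V → ℕ
  deg v = length (filter (v ~?_) vertices)

  -- The graph without vertices gets maximum degree 0.
  Δ : ℕ
  Δ = max 0 (map deg vertices)

  ∈-vertices : ∀ v → v ∈ vertices
  ∈-vertices v = subst (_∈ vertices) (Inverse.strictlyInverseʳ finite v) (∈-map⁺ unrank (∈-allFin (rank v)))

  -- An edge is an unordered pair of adjacent vertices, represented by listing
  -- its ends in increasing rank. The proofs are irrelevant, so two edges are
  -- equal (_≡_) exactly when they have the same ends.
  record Edge : Set where
    eta-equality
    constructor edge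
    field
      end₁ end₂ : V
      .ordered  : rank end₁ <ᶠ rank end₂
      .adjacent : end₁ ~ end₂

  open Edge public

  infix 4 _∈ᵉ_
  _∈ᵉ_ : V → Edge → Set
  v ∈ᵉ e = v ≡ end₁ e ⊎ v ≡ end₂ e

  -- uv = e as unordered pairs
  Joins : V → V → Edge → Set
  Joins u v e = (u ≡ end₁ e × v ≡ end₂ e) ⊎ (u ≡ end₂ e × v ≡ end₁ e)

  record Incidence : Set where
    eta-equality
    constructor incidence
    field
      vertex   : V
      theEdge  : Edge
      .vertex∈ : vertex ∈ᵉ theEdge

  open Incidence public

  AdjacentInc : Incidence → Incidence → Set
  AdjacentInc i j =
    vertex i ≡ vertex j
    ⊎ theEdge i ≡ theEdge j
    ⊎ (Joins (vertex i) (vertex j) (theEdge i) ⊎ Joins (vertex i) (vertex j) (theEdge j))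

  -- AdjacentInc is reflexive; only distinct incidences are constrained.
  IsIncidenceColoring : ∀ {k} → (Incidence → Fin k) → Set
  IsIncidenceColoring c = ∀ i j → i ≢ j → AdjacentInc i j → c i ≢ c j

  IncidenceColorable : ℕ → Set
  IncidenceColorable k = Σ (Incidence → Fin k) IsIncidenceColoring

  infix 4 _∈S⁰[_,_]
  _∈S⁰[_,_] : ∀ {k} → Fin k → (Incidence → Fin k) → V → Set
  x ∈S⁰[ c , v ] = ∃[ i ] (vertex i ≡ v × c i ≡ x)

  Adjustable : ∀ {k} → (Incidence → Fin k) → Set
  Adjustable c = ∃[ x ] ∃[ y ] (x ≢ y × (∀ v → ¬ (x ∈S⁰[ c , v ] × y ∈S⁰[ c , v ])))

  -- Decidability of IncidenceColorable, needed for its least witness χᵢ.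

  Edge-≡ : ∀ {e f : Edge} → end₁ e ≡ end₁ f → end₂ e ≡ end₂ f → e ≡ f
  Edge-≡ {edge _ _ _ _} {edge _ _ _ _} refl refl = refl

  Incidence-≡ : ∀ {i j : Incidence} → vertex i ≡ vertex j → theEdge i ≡ theEdge j → i ≡ j
  Incidence-≡ {incidence _ _ _} {incidence _ _ _} refl refl = refl

  _≟ᵉ_ : DecidableEquality Edge
  e ≟ᵉ f = map′ (λ (p , q) → Edge-≡ p q) (λ { refl → refl , refl })
                (end₁ e ≟ end₁ f ×-dec end₂ e ≟ end₂ f)

  _≟ⁱ_ : DecidableEquality Incidence
  i ≟ⁱ j = map′ (λ (p , q) → Incidence-≡ p q) (λ { refl → refl , refl })
                (vertex i ≟ vertex j ×-dec theEdge i ≟ᵉ theEdge j)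

  Joins? : ∀ u v e → Dec (Joins u v e)
  Joins? u v e = (u ≟ end₁ e ×-dec v ≟ end₂ e) ⊎-dec (u ≟ end₂ e ×-dec v ≟ end₁ e)

  AdjacentInc? : Decidable AdjacentInc
  AdjacentInc? i j =
    vertex i ≟ vertex j
    ⊎-dec (theEdge i ≟ᵉ theEdge j
    ⊎-dec (Joins? (vertex i) (vertex j) (theEdge i) ⊎-dec Joins? (vertex i) (vertex j) (theEdge j)))

  private
    IsInc : V × V × V → Set
    IsInc (v , a , b) = (rank a <ᶠ rank b × a ~ b) × (v ≡ a ⊎ v ≡ b)

    IsInc? : ∀ t → Dec (IsInc t)
    IsInc? (v , a , b) = (rank a Fin.<? rank b ×-dec a ~? b) ×-dec (v ≟ a ⊎-dec v ≟ b)

    toInc : ∀ t → Dec (IsInc t) → Maybe Incidence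
    toInc (v , a , b) (yes ((p , q) , r)) = just (incidence v (edge a b p q) r)
    toInc _           (no _)              = nothing

    triple : Incidence → V × V × V
    triple i = vertex i , end₁ (theEdge i) , end₂ (theEdge i)

    toInc-triple : ∀ i d → toInc (triple i) d ≡ just i
    toInc-triple i (yes _) = refl
    toInc-triple i@(incidence v (edge a b p q) r) (no ¬p) =
      contradiction ((recompute (rank a Fin.<? rank b) p , recompute (a ~? b) q) ,
                     recompute (v ≟ a ⊎-dec v ≟ b) r) ¬p

    ∈-mapMaybe : ∀ {A B : Set} (f : A → Maybe B) {x y xs} → x ∈ xs → f x ≡ just y → y ∈ mapMaybe f xs
    ∈-mapMaybe f {x} (here refl) eq with f x | eq
    ... | just _ | refl = here refl
    ∈-mapMaybe f {xs = z ∷ _} (there p) eq with f z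
    ... | just _  = there (∈-mapMaybe f p eq)
    ... | nothing = ∈-mapMaybe f p eq

  incidences : List Incidence
  incidences = mapMaybe (λ t → toInc t (IsInc? t))
                        (cartesianProduct vertices (cartesianProduct vertices vertices))

  ∈-incidences : ∀ i → i ∈ incidences
  ∈-incidences i =
    ∈-mapMaybe (λ t → toInc t (IsInc? t))
      (∈-cartesianProduct⁺ (∈-vertices _) (∈-cartesianProduct⁺ (∈-vertices _) (∈-vertices _)))
      (toInc-triple i (IsInc? (triple i)))

  private
    position : Incidence → Fin (length incidences)
    position i = index (∈-incidences i)

    lookup-position : ∀ i → lookup incidences (position i) ≡ i
    lookup-position i = sym (lookup-index (∈-incidences i))

    allInc? : ∀ {P : Incidence → Set} → (∀ i → Dec (P i)) → Dec (∀ i → P i)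
    allInc? {P} P? = map′ (λ h i → subst P (lookup-position i) (h (position i))) (λ h → h ∘ lookup incidences)
                          (Fin.all? (P? ∘ lookup incidences))

    isIncidenceColoring? : ∀ {k} (c : Incidence → Fin k) → Dec (IsIncidenceColoring c)
    isIncidenceColoring? c = allInc? λ i → allInc? λ j →
      ¬? (i ≟ⁱ j) →-dec (AdjacentInc? i j →-dec ¬? (c i Fin.≟ c j))

    isIncidenceColoring-resp : ∀ {k} {c d : Incidence → Fin k} → (∀ i → c i ≡ d i) →
                               IsIncidenceColoring c → IsIncidenceColoring d
    isIncidenceColoring-resp c≗d ok i j i≢j adj eq =
      ok i j i≢j adj (trans (c≗d i) (trans eq (sym (c≗d j))))

  incidenceColorable? : ∀ k → Dec (IncidenceColorable k)
  incidenceColorable? k = map′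
    (λ (n , ok) → decode n , ok)
    (λ (c , ok) → funToFin (c ∘ lookup incidences) ,
       isIncidenceColoring-resp
         (λ i → sym (trans (Fin.finToFun-funToFin (c ∘ lookup incidences) (position i))
                           (cong c (lookup-position i))))
         ok)
    (Fin.any? (λ n → isIncidenceColoring? (decode n)))
    where
    decode : Fin _ → Incidence → Fin k
    decode n = finToFun {k} {length incidences} n ∘ position

  incidenceColorable-many : IncidenceColorable (length incidences)
  incidenceColorable-many = position , λ i j i≢j _ eq →
    i≢j (trans (sym (lookup-position i)) (trans (cong (lookup incidences) eq) (lookup-position j)))

least : ∀ {P : ℕ → Set} → (∀ n → Dec (P n)) → ∀ n → P n → ∃[ k ] (P k × (∀ j → P j → k ≤ j))
least P? zero p = zero , p , λ _ _ → z≤n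
least P? (suc n) p with P? zero
... | yes p₀ = zero , p₀ , λ _ _ → z≤n
... | no ¬p₀ with least (P? ∘ suc) n p
...   | k , pk , k-least = suc k , pk , λ where
        zero    p₀ → contradiction p₀ ¬p₀
        (suc j) pj → s≤s (k-least j pj)

open Graph using (V; Δ)

private
  leastColoring : (G : Graph) →
    ∃[ k ] (Graph.IncidenceColorable G k × (∀ j → Graph.IncidenceColorable G j → k ≤ j))
  leastColoring G = least (Graph.incidenceColorable? G) _ (Graph.incidenceColorable-many G)

χᵢ : Graph → ℕ
χᵢ G = proj₁ (leastColoring G)

χᵢ-colorable : ∀ G → Graph.IncidenceColorable G (χᵢ G)
χᵢ-colorable G = proj₁ (proj₂ (leastColoring G))

χᵢ-least : ∀ G k → Graph.IncidenceColorable G k → χᵢ G ≤ k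
χᵢ-least G = proj₂ (proj₂ (leastColoring G))

IsHomomorphism : (G H : Graph) → (V G → V H) → Set
IsHomomorphism G H f = ∀ u v → u ~ᴳ v → f u ~ᴴ f v
  where open Graph G using () renaming (_~_ to _~ᴳ_)
        open Graph H using () renaming (_~_ to _~ᴴ_)

IsLocallyInjective : (G H : Graph) → (V G → V H) → Set
IsLocallyInjective G H f = ∀ v u w → v ~ u → v ~ w → f u ≡ f w → u ≡ w
  where open Graph G using (_~_)

-- K⁻ n has 2n vertices; the removed perfect matching pairs (i , 0) with (i , 1).
K⁻ : ℕ → Graph
K⁻ n = record
  { V      = Fin n × Fin 2
  ; order  = n * 2
  ; finite = ↔-sym Fin.*↔×
  ; _~_    = λ p q → p ≢ q × ¬ Matched p q
  ; _~?_   = λ p q → ¬? (≡-dec Fin._≟_ Fin._≟_ p q) ×-dec ¬? (matched? p q)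
  ; ~-sym  = λ (p≢q , ¬m) → p≢q ∘ sym , λ (i≡j , a≢b) → ¬m (sym i≡j , a≢b ∘ sym)
  ; ~-irr  = λ _ (p≢p , _) → p≢p refl
  }
  where
  Matched : Fin n × Fin 2 → Fin n × Fin 2 → Set
  Matched (i , a) (j , b) = i ≡ j × a ≢ b

  matched? : Decidable Matched
  matched? (i , a) (j , b) = i Fin.≟ j ×-dec ¬? (a Fin.≟ b)

infixr 6 _□_
_□_ : Graph → Graph → Graph
G □ H = record
  { V      = G.V × H.V
  ; order  = G.order * H.order
  ; finite = ↔-sym Fin.*↔× ↔-∘ (G.finite ×-↔ H.finite)
  ; _~_    = λ (u , v) (u′ , v′) → (u G.~ u′ × v ≡ v′) ⊎ (u ≡ u′ × v H.~ v′)
  ; _~?_   = λ (u , v) (u′ , v′) → (u G.~? u′ ×-dec v H.≟ v′) ⊎-dec (u G.≟ u′ ×-dec v H.~? v′)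
  ; ~-sym  = λ { (inj₁ (e , p)) → inj₁ (G.~-sym e , sym p)
               ; (inj₂ (p , e)) → inj₂ (sym p , H.~-sym e) }
  ; ~-irr  = λ { (u , v) (inj₁ (e , _)) → G.~-irr u e
               ; (u , v) (inj₂ (_ , e)) → H.~-irr v e }
  }
  where module G = Graph G
        module H = Graph H

-- K⁻ on Δ(G) + 2 vertices exists only when Δ(G) + 2 is even, so evenness of
-- Δ(G) is part of the definition.
Sub2Permutable : Graph → Set
Sub2Permutable G = ∃[ n ] (Δ G + 2 ≡ 2 * n ×
  (∃[ f ] (IsHomomorphism G (K⁻ n) f × IsLocallyInjective G (K⁻ n) f)))

TwoAdjustable : Graph → Set
TwoAdjustable H = Σ (Graph.Incidence H → Fin (Δ H + 2)) λ c →
  Graph.IsIncidenceColoring H c × Graph.Adjustable H c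

{-# OPTIONS --safe #-}

-- Read an incidence (u , uv) as the arc u → v. An incidence coloring is then an arc coloring in which
-- arcs with a common tail, and consecutive arcs u → v → w, get distinct colors.
--
-- Write p̄ for the partner of a vertex p of K⁻ under the removed matching, let f : G → K⁻ be the given
-- homomorphism and x, y the two special colors of H. The palette of G □ H consists of the vertices of
-- K⁻ together with the colors of H other than x and y, which makes (Δ G + 2) + Δ H colors. In the copy
-- of H over a vertex u of G the colors x and y are replaced by f u and its partner, both of which are
-- unused by f on the neighbors of u. In the copy of G over a vertex v of H the arc u → u′ gets the
-- color f u′ if x is missing from S⁰(v), and the partner of f u′ otherwise, when y is missing. Hence
-- the arcs entering (u , v) within G and those leaving it within H have different colors.

module Submission where

open import Defs
open import Data.Empty using (⊥-elim; ⊥-elim-irr)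
open import Data.Fin using (Fin; zero; suc; opposite; punchOut; join; splitAt; combine; inject≤)
import Data.Fin.Properties as Fin
open import Data.List using (List; _++_; map; filter; length; lookup)
open import Data.List.Extrema.Nat using (argmax-sel; xs≤max)
open import Data.List.Membership.Propositional using (_∈_; lose; find)
open import Data.List.Membership.Propositional.Properties using (∈-map⁺; ∈-map⁻; ∈-++⁻; ∈-filter⁺; ∈-filter⁻; ∈-lookup)
open import Data.List.Membership.Setoid.Properties using (index-injective)
open import Data.List.Properties using (length-++; length-map)
open import Data.List.Relation.Binary.Subset.Propositional using (_⊆_)
import Data.List.Relation.Unary.All as All
open import Data.List.Relation.Unary.AllPairs using (_∷_)
open import Data.List.Relation.Unary.Any using (any?)
open import Data.List.Relation.Unary.Unique.Propositional using (Unique)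
import Data.List.Relation.Unary.Unique.Propositional.Properties as Unique
open import Data.Nat using (ℕ; zero; suc; _+_; _*_; _≤_; z≤n)
import Data.Nat.Properties as ℕ
open import Data.Product using (Σ; ∃-syntax; _×_; _,_; proj₁; proj₂)
open import Data.Sum as Sum using (_⊎_; inj₁; inj₂)
open import Data.Sum.Properties using (inj₁-injective; inj₂-injective)
open import Function using (_∘_; Injective; Inverse)
open import Relation.Binary using (tri<; tri≈; tri>)
open import Relation.Binary.PropositionalEquality using (_≡_; _≢_; refl; sym; trans; cong; cong₂; subst; setoid)
open import Relation.Nullary using (¬_; Dec; yes; no; contradiction)
open import Relation.Nullary.Decidable using (map′; recompute; _×-dec_; _⊎-dec_; _→-dec_; from-yes)

-- Lists without repetition

lookup-injective : ∀ {A : Set} {xs : List A} → Unique xs → Injective _≡_ _≡_ (lookup xs)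
lookup-injective (_ ∷ _)    {zero}  {zero}  _  = refl
lookup-injective (x∉ ∷ _)   {zero}  {suc j} eq = contradiction eq (All.lookup x∉ (∈-lookup j))
lookup-injective (x∉ ∷ _)   {suc i} {zero}  eq = contradiction (sym eq) (All.lookup x∉ (∈-lookup i))
lookup-injective (_ ∷ uniq) {suc i} {suc j} eq = cong suc (lookup-injective uniq eq)

-- Sending each position of `xs` to the position of the same element in `ys` is injective, as `xs`
-- has no repetition.
unique-⊆⇒length≤ : ∀ {A : Set} {xs ys : List A} → Unique xs → xs ⊆ ys → length xs ≤ length ys
unique-⊆⇒length≤ {A} {xs} uniq xs⊆ys = Fin.injective⇒≤ λ {i} {j} eq →
  lookup-injective uniq
    (index-injective (setoid A) (xs⊆ys (∈-lookup {xs = xs} i)) (xs⊆ys (∈-lookup {xs = xs} j)) eq)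

-- Degrees in a Cartesian product

inhabited? : (G : Graph) → Dec (Graph.V G)
inhabited? G = map′ unrank rank (fin? order)
  where
  open Graph G
  fin? : ∀ n → Dec (Fin n)
  fin? zero    = no λ ()
  fin? (suc n) = yes zero

module _ (G : Graph) where
  open Graph G

  neighbors : V → List V
  neighbors v = filter (v ~?_) vertices

  neighbors-unique : ∀ v → Unique (neighbors v)
  neighbors-unique v = Unique.filter⁺ (v ~?_) (Unique.map⁺ unrank-injective (Unique.allFin⁺ order))
    where
    unrank-injective : Injective _≡_ _≡_ unrank
    unrank-injective {i} {j} eq =
      trans (sym (Inverse.strictlyInverseˡ finite i)) (trans (cong rank eq) (Inverse.strictlyInverseˡ finite j))

  ∈-neighbors⁺ : ∀ {u v} → u ~ v → v ∈ neighbors u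
  ∈-neighbors⁺ {u} {v} = ∈-filter⁺ (u ~?_) (∈-vertices v)

  ∈-neighbors⁻ : ∀ {u v} → v ∈ neighbors u → u ~ v
  ∈-neighbors⁻ {u} v∈ = proj₂ (∈-filter⁻ (u ~?_) {xs = vertices} v∈)

  deg≤Δ : ∀ v → deg v ≤ Δ
  deg≤Δ v = All.lookup (xs≤max 0 (map deg vertices)) (∈-map⁺ deg (∈-vertices v))

  Δ-attained : V → ∃[ v ] (Δ ≤ deg v)
  Δ-attained v₀ with argmax-sel (λ n → n) 0 (map deg vertices)
  -- The maximum is the default value 0, so any vertex serves.
  ... | inj₁ Δ≡0 = v₀ , subst (_≤ deg v₀) (sym Δ≡0) z≤n
  ... | inj₂ Δ∈  with v , _ , Δ≡deg ← ∈-map⁻ deg Δ∈ = v , ℕ.≤-reflexive Δ≡deg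

module _ (G H : Graph) where
  private
    module G = Graph G
    module H = Graph H
    module G□H = Graph (G □ H)

  -- The neighbors along `G` and those along `H` are disjoint, since `u` is not adjacent to itself,
  -- so the two lists together have no repetition.
  deg-□ : ∀ u v → G.deg u + H.deg v ≤ G□H.deg (u , v)
  deg-□ u v = begin
    G.deg u + H.deg v
      ≡⟨ cong₂ _+_ (length-map (_, v) (neighbors G u)) (length-map (u ,_) (neighbors H v)) ⟨
    length along-G + length along-H
      ≡⟨ length-++ along-G ⟨
    length (along-G ++ along-H)
      ≤⟨ unique-⊆⇒length≤ unique ⊆neighbors ⟩
    G□H.deg (u , v) ∎
    where
    open ℕ.≤-Reasoning
    along-G along-H : List G□H.V
    along-G = map (_, v) (neighbors G u)
    along-H = map (u ,_) (neighbors H v)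

    unique : Unique (along-G ++ along-H)
    unique = Unique.++⁺ (Unique.map⁺ (cong proj₁) (neighbors-unique G u))
                        (Unique.map⁺ (cong proj₂) (neighbors-unique H v))
                        disjoint
      where
      disjoint : ∀ {p} → ¬ (p ∈ along-G × p ∈ along-H)
      disjoint (p∈ , q∈) with ∈-map⁻ (_, v) p∈ | ∈-map⁻ (u ,_) q∈
      ... | _ , u′∈ , refl | _ , _ , refl = G.~-irr u (∈-neighbors⁻ G u′∈)

    ⊆neighbors : along-G ++ along-H ⊆ neighbors (G □ H) (u , v)
    ⊆neighbors p∈ with ∈-++⁻ along-G p∈
    ... | inj₁ q∈ with _ , u′∈ , refl ← ∈-map⁻ (_, v) q∈ = ∈-neighbors⁺ (G □ H) (inj₁ (∈-neighbors⁻ G u′∈ , refl))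
    ... | inj₂ q∈ with _ , v′∈ , refl ← ∈-map⁻ (u ,_) q∈ = ∈-neighbors⁺ (G □ H) (inj₂ (refl , ∈-neighbors⁻ H v′∈))

  Δ-□ : G.V → H.V → G.Δ + H.Δ ≤ G□H.Δ
  Δ-□ u₀ v₀ =
    let u , Δ≤u = Δ-attained G u₀
        v , Δ≤v = Δ-attained H v₀
    in ℕ.≤-trans (ℕ.+-mono-≤ Δ≤u Δ≤v) (ℕ.≤-trans (deg-□ u v) (deg≤Δ (G □ H) (u , v)))

-- Incidence colorings as arc colorings

module _ (G : Graph) where
  open Graph G

  -- In `through`, `w` may be `u`; this covers the two incidences of a single edge. The palette is
  -- an arbitrary type, so that it can be a sum.
  record IsArcColoring {C : Set} (κ : ∀ u v → u ~ v → C) : Set where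
    field
      out     : ∀ {u v w} (e : u ~ v) (e′ : u ~ w) → v ≢ w → κ u v e ≢ κ u w e′
      through : ∀ {u v w} (e : u ~ v) (e′ : v ~ w) → κ u v e ≢ κ v w e′

  Joins⇒~ : ∀ {u v} e → Joins u v e → u ~ v
  Joins⇒~ (edge a b _ a~b) (inj₁ (refl , refl)) = recompute (a ~? b) a~b
  Joins⇒~ (edge a b _ a~b) (inj₂ (refl , refl)) = ~-sym (recompute (a ~? b) a~b)

  ~⇒≢ : ∀ {u v} → u ~ v → u ≢ v
  ~⇒≢ {u} u~u refl = ~-irr u u~u

  Joins-end : ∀ {u v w} e → Joins u v e → Joins u w e → v ≡ w
  Joins-end e (inj₁ (_ , refl)) (inj₁ (_ , refl)) = refl
  Joins-end e (inj₂ (_ , refl)) (inj₂ (_ , refl)) = refl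
  Joins-end e J@(inj₁ (_ , v≡b)) (inj₂ (u≡b , _)) = contradiction (trans u≡b (sym v≡b)) (~⇒≢ (Joins⇒~ e J))
  Joins-end e J@(inj₂ (_ , v≡a)) (inj₁ (u≡a , _)) = contradiction (trans u≡a (sym v≡a)) (~⇒≢ (Joins⇒~ e J))

  Joins-sym : ∀ {u v} e → Joins u v e → Joins v u e
  Joins-sym e (inj₁ (p , q)) = inj₂ (q , p)
  Joins-sym e (inj₂ (p , q)) = inj₁ (q , p)

  Joins-edge : ∀ {u v} e f → Joins u v e → Joins u v f → e ≡ f
  Joins-edge e f (inj₁ (refl , refl)) (inj₁ (p , q)) = Edge-≡ p q
  Joins-edge e f (inj₂ (refl , refl)) (inj₂ (p , q)) = Edge-≡ q p
  -- Ends are listed by increasing rank, so a pair cannot be listed in both orders.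
  Joins-edge (edge _ _ u<v _) (edge _ _ v<u _) (inj₁ (refl , refl)) (inj₂ (refl , refl)) =
    ⊥-elim-irr (Fin.<-asym u<v v<u)
  Joins-edge (edge _ _ v<u _) (edge _ _ u<v _) (inj₂ (refl , refl)) (inj₁ (refl , refl)) =
    ⊥-elim-irr (Fin.<-asym u<v v<u)

  Joins-∈ : ∀ {u v} e → Joins u v e → u ∈ᵉ e
  Joins-∈ e (inj₁ (p , _)) = inj₁ p
  Joins-∈ e (inj₂ (p , _)) = inj₂ p

  joined : ∀ {u v} → u ~ v → ∃[ e ] Joins u v e
  joined {u} {v} u~v with Fin.<-cmp (rank u) (rank v)
  ... | tri< u<v _ _ = edge u v u<v u~v , inj₁ (refl , refl)
  ... | tri> _ _ v<u = edge v u v<u (~-sym u~v) , inj₂ (refl , refl)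
  ... | tri≈ _ eq _  = contradiction u≡v (~⇒≢ u~v)
    where
    u≡v : u ≡ v
    u≡v = trans (sym (Inverse.strictlyInverseʳ finite u)) (trans (cong unrank eq) (Inverse.strictlyInverseʳ finite v))

  arc : ∀ {u v} → u ~ v → Incidence
  arc {u} u~v = incidence u (proj₁ (joined u~v)) (Joins-∈ (proj₁ (joined u~v)) (proj₂ (joined u~v)))

  head : ∀ i → ∃[ v ] Joins (vertex i) v (theEdge i)
  head (incidence u e u∈) with recompute ((u ≟ end₁ e) ⊎-dec (u ≟ end₂ e)) u∈
  ... | inj₁ p = end₂ e , inj₁ (p , refl)
  ... | inj₂ p = end₁ e , inj₂ (p , refl)

  isIncidenceColoring⇒isArcColoring : ∀ {k} {c : Incidence → Fin k} → IsIncidenceColoring c →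
    IsArcColoring (λ _ _ e → c (arc e))
  isIncidenceColoring⇒isArcColoring ok = record
    { out     = λ e e′ v≢w → ok (arc e) (arc e′)
        (λ eq → v≢w (Joins-end (proj₁ (joined e)) (proj₂ (joined e))
                       (subst (Joins _ _) (sym (cong theEdge eq)) (proj₂ (joined e′)))))
        (inj₁ refl)
    ; through = λ e e′ → ok (arc e) (arc e′)
        (~⇒≢ e ∘ cong vertex)
        -- The edge of the first arc joins the tails of the two arcs.
        (inj₂ (inj₂ (inj₁ (proj₂ (joined e)))))
    }

  isArcColoring⇒colorable : ∀ {C : Set} {k} {κ : ∀ u v → u ~ v → C} {ι : C → Fin k} →
    IsArcColoring κ → Injective _≡_ _≡_ ι → IncidenceColorable k
  isArcColoring⇒colorable {C} {k} {κ} {ι} ok ι-injective =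
    (λ i → ι (color i)) , λ i j i≢j adj → color-≢ i j i≢j adj ∘ ι-injective
    where
    open IsArcColoring ok

    color : Incidence → C
    color i = κ (vertex i) (proj₁ (head i)) (Joins⇒~ (theEdge i) (proj₂ (head i)))

    through′ : ∀ {u v v′ w} (e : u ~ v) (e′ : v′ ~ w) → v ≡ v′ → κ u v e ≢ κ v′ w e′
    through′ e e′ refl = through e e′

    color-≢ : ∀ i j → i ≢ j → AdjacentInc i j → color i ≢ color j
    color-≢ i j i≢j adj with head i | head j
    ... | v , J | w , K with adj
    ...   | inj₁ refl = out (Joins⇒~ (theEdge i) J) (Joins⇒~ (theEdge j) K)
      λ { refl → i≢j (Incidence-≡ refl (Joins-edge (theEdge i) (theEdge j) J K)) }
    ...   | inj₂ (inj₂ (inj₁ L)) =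
      through′ (Joins⇒~ (theEdge i) J) (Joins⇒~ (theEdge j) K) (Joins-end (theEdge i) J L)
    ...   | inj₂ (inj₂ (inj₂ L)) =
      through′ (Joins⇒~ (theEdge j) K) (Joins⇒~ (theEdge i) J) (Joins-end (theEdge j) K (Joins-sym (theEdge j) L)) ∘ sym
    -- Distinct incidences of one edge have opposite tails, so their arcs run there and back and are
    -- consecutive.
    ...   | inj₂ (inj₁ refl) with J | K
    ...     | inj₁ (p , _) | inj₁ (q , _) = λ _ → i≢j (Incidence-≡ (trans p (sym q)) refl)
    ...     | inj₂ (p , _) | inj₂ (q , _) = λ _ → i≢j (Incidence-≡ (trans p (sym q)) refl)
    ...     | inj₁ (_ , p) | inj₂ (q , _) = through′ _ _ (trans p (sym q))
    ...     | inj₂ (_ , p) | inj₁ (q , _) = through′ _ _ (trans p (sym q))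

-- Palettes

-- Splits off `x` and `y` so that they alone can be renamed in each copy of `H`; the other colors
-- are renumbered by deleting first `x`, then `y`.
isolate₂ : ∀ {m d} → m ≡ 2 + d → (x y : Fin m) → x ≢ y →
  Σ (Fin m → Fin 2 ⊎ Fin d) λ ρ → Injective _≡_ _≡_ ρ × ρ x ≡ inj₁ zero × ρ y ≡ inj₁ (suc zero)
isolate₂ {d = d} refl x y x≢y = ρ , ρ-injective , ρx , ρy
  where
  ρ′ : ∀ z → Dec (x ≡ z) → Dec (y ≡ z) → Fin 2 ⊎ Fin d
  ρ′ z (yes _)  _         = inj₁ zero
  ρ′ z (no _)   (yes _)   = inj₁ (suc zero)
  ρ′ z (no x≢z) (no y≢z) = inj₂ (punchOut (y≢z ∘ Fin.punchOut-injective x≢y x≢z))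

  ρ : Fin (2 + d) → Fin 2 ⊎ Fin d
  ρ z = ρ′ z (x Fin.≟ z) (y Fin.≟ z)

  ρ′-injective : ∀ z w p q r s → ρ′ z p q ≡ ρ′ w r s → z ≡ w
  ρ′-injective z w (yes refl) _ (yes refl) _ _ = refl
  ρ′-injective z w (no _) (yes refl) (no _) (yes refl) _ = refl
  ρ′-injective z w (no x≢z) (no y≢z) (no x≢w) (no y≢w) eq =
    Fin.punchOut-injective x≢z x≢w
      (Fin.punchOut-injective (y≢z ∘ Fin.punchOut-injective x≢y x≢z) (y≢w ∘ Fin.punchOut-injective x≢y x≢w)
        (inj₂-injective eq))
  ρ′-injective z w (yes _) _ (no _) (yes _) ()
  ρ′-injective z w (yes _) _ (no _) (no _) ()
  ρ′-injective z w (no _) (yes _) (yes _) _ ()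
  ρ′-injective z w (no _) (no _) (yes _) _ ()
  ρ′-injective z w (no _) (yes _) (no _) (no _) ()
  ρ′-injective z w (no _) (no _) (no _) (yes _) ()

  ρ-injective : Injective _≡_ _≡_ ρ
  ρ-injective {z} {w} = ρ′-injective z w _ _ _ _

  ρx : ρ x ≡ inj₁ zero
  ρx with x Fin.≟ x
  ... | yes _  = refl
  ... | no x≢x = contradiction refl x≢x

  ρy : ρ y ≡ inj₁ (suc zero)
  ρy with x Fin.≟ y | y Fin.≟ y
  ... | yes x≡y | _      = contradiction x≡y x≢y
  ... | no _    | yes _  = refl
  ... | no _    | no y≢y = contradiction refl y≢y

infixl 6 _⊕_
-- Addition modulo 2.
_⊕_ : Fin 2 → Fin 2 → Fin 2
zero  ⊕ b = b
suc _ ⊕ b = opposite b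

⊕-cancelˡ : ∀ a b c → a ⊕ b ≡ a ⊕ c → b ≡ c
⊕-cancelˡ = from-yes (Fin.all? λ a → Fin.all? λ b → Fin.all? λ c → (a ⊕ b Fin.≟ a ⊕ c) →-dec (b Fin.≟ c))

⊕-cancelʳ : ∀ c a b → a ⊕ c ≡ b ⊕ c → a ≡ b
⊕-cancelʳ = from-yes (Fin.all? λ c → Fin.all? λ a → Fin.all? λ b → (a ⊕ c Fin.≟ b ⊕ c) →-dec (a Fin.≟ b))

-- shift p 0 is p, and shift p 1 is the partner of p under the matching removed in K⁻.
shift : ∀ {n} → Fin n × Fin 2 → Fin 2 → Fin n × Fin 2
shift (i , a) b = i , a ⊕ b

shift-injectiveˡ : ∀ {n} b {p q : Fin n × Fin 2} → shift p b ≡ shift q b → p ≡ q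
shift-injectiveˡ b {_ , a} {_ , a′} eq = cong₂ _,_ (cong proj₁ eq) (⊕-cancelʳ b a a′ (cong proj₂ eq))

shift-injectiveʳ : ∀ {n} (p : Fin n × Fin 2) {b c} → shift p b ≡ shift p c → b ≡ c
shift-injectiveʳ (_ , a) {b} {c} eq = ⊕-cancelˡ a b c (cong proj₂ eq)

-- Adjacent vertices of `K⁻ n` lie in different matched pairs, and `shift` moves a vertex only
-- within its pair.
shift-≢ : ∀ {n} {p q : Fin n × Fin 2} → Graph._~_ (K⁻ n) p q → ∀ b c → shift p b ≢ shift q c
shift-≢ {p = i , a} {j , a′} (p≢q , ¬m) b c eq = ¬m (i≡j , λ a≡a′ → p≢q (cong₂ _,_ i≡j a≡a′))
  where
  i≡j : i ≡ j
  i≡j = cong proj₁ eq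

map₁-injective : ∀ {A A′ B : Set} {g : A → A′} → Injective _≡_ _≡_ g → Injective _≡_ _≡_ (Sum.map₁ {B = B} g)
map₁-injective inj {inj₁ _} {inj₁ _} eq = cong inj₁ (inj (inj₁-injective eq))
map₁-injective inj {inj₂ _} {inj₂ _} refl = refl

flatten : ∀ {n d} → (Fin n × Fin 2) ⊎ Fin d → Fin (n * 2 + d)
flatten {n} {d} = join (n * 2) d ∘ Sum.map₁ λ (i , a) → combine i a

flatten-injective : ∀ {n d} → Injective _≡_ _≡_ (flatten {n} {d})
flatten-injective {n} {d} eq = map₁-injective pair-injective (join-injective eq)
  where
  pair-injective : Injective _≡_ _≡_ (λ ((i , a) : Fin n × Fin 2) → combine i a)
  pair-injective {i , a} {j , b} eq with refl , refl ← Fin.combine-injective i a j b eq = refl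

  join-injective : Injective _≡_ _≡_ (join (n * 2) d)
  join-injective {s} {t} eq =
    trans (sym (Fin.splitAt-join (n * 2) d s)) (trans (cong (splitAt (n * 2)) eq) (Fin.splitAt-join (n * 2) d t))

-- The coloring of the product

module _ (G H : Graph) {n d : ℕ}
         {f : Graph.V G → Fin n × Fin 2}
         (hom : IsHomomorphism G (K⁻ n) f) (loc-inj : IsLocallyInjective G (K⁻ n) f)
         {κ : ∀ u v → Graph._~_ H u v → Fin 2 ⊎ Fin d} (κ-ok : IsArcColoring H κ)
         {free : Graph.V H → Fin 2} (free-ok : ∀ {v w} e → κ v w e ≢ inj₁ (free v))
         where
  private
    module G = Graph G
    module H = Graph H
    module G□H = Graph (G □ H)
    module κ = IsArcColoring κ-ok

  □-color : ∀ p q → p G□H.~ q → (Fin n × Fin 2) ⊎ Fin d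
  □-color (u , v) (u′ , v′) (inj₁ _)       = inj₁ (shift (f u′) (free v))
  □-color (u , v) (u′ , v′) (inj₂ (_ , e)) = Sum.map₁ (shift (f u)) (κ v v′ e)

  private
    recolor-injective : ∀ u → Injective _≡_ _≡_ (Sum.map₁ {B = Fin d} (shift (f u)))
    recolor-injective u = map₁-injective (shift-injectiveʳ (f u))

    -- A special color becomes a member of the pair of `f u`, which differs from the pair of `f u′`;
    -- every other color stays in the other summand.
    recolor-≢ : ∀ {u u′} → u G.~ u′ → ∀ z b → Sum.map₁ (shift (f u)) z ≢ inj₁ {B = Fin d} (shift (f u′) b)
    recolor-≢ e (inj₁ a) b eq = shift-≢ (hom _ _ e) a b (inj₁-injective eq)

  □-color-isArcColoring : IsArcColoring (G □ H) □-color
  □-color-isArcColoring = record { out = out ; through = through }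
    where
    out : ∀ {p q r} (e : p G□H.~ q) (e′ : p G□H.~ r) → q ≢ r → □-color p q e ≢ □-color p r e′
    -- Both arcs are shifted by the same `free v`, so equal colors force equal images under `f` of
    -- two neighbors of `u`.
    out {u , v} (inj₁ (e , refl)) (inj₁ (e′ , refl)) q≢r eq =
      q≢r (cong (_, v) (loc-inj _ _ _ e e′ (shift-injectiveˡ (free v) (inj₁-injective eq))))
    out {u , v} (inj₂ (refl , e)) (inj₂ (refl , e′)) q≢r eq =
      κ.out e e′ (q≢r ∘ cong (u ,_)) (recolor-injective u eq)
    out (inj₁ (e , refl)) (inj₂ (refl , e′)) _ eq = recolor-≢ e (κ _ _ e′) _ (sym eq)
    out (inj₂ (refl , e)) (inj₁ (e′ , refl)) _ eq = recolor-≢ e′ (κ _ _ e) _ eq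

    through : ∀ {p q r} (e : p G□H.~ q) (e′ : q G□H.~ r) → □-color p q e ≢ □-color q r e′
    -- The colors come from the images of the two heads, which are adjacent by `e′`.
    through {u , v} (inj₁ (e , refl)) (inj₁ (e′ , refl)) eq = shift-≢ (hom _ _ e′) _ _ (inj₁-injective eq)
    through {u , v} (inj₂ (refl , e)) (inj₂ (refl , e′)) eq = κ.through e e′ (recolor-injective u eq)
    -- Both colors are read relative to `f u`; undoing the shift would make `free v` the color of an
    -- arc leaving `v`.
    through {q = u , v} (inj₁ (e , refl)) (inj₂ (refl , e′)) eq =
      free-ok e′ (recolor-injective u (sym eq))
    through (inj₂ (refl , e)) (inj₁ (e′ , refl)) eq = recolor-≢ e′ (κ _ _ e) _ eq

-- Allows a missing special color to be chosen at each vertex by cases.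
∈S⁰? : ∀ (H : Graph) {k} (x : Fin k) (c : Graph.Incidence H → Fin k) v → Dec (Graph._∈S⁰[_,_] H x c v)
∈S⁰? H x c v = map′ (λ hit → let i , _ , p = find hit in i , p) (λ (i , p) → lose (∈-incidences i) p)
                    (any? (λ i → (vertex i ≟ v) ×-dec (c i Fin.≟ x)) incidences)
  where open Graph H

□-colorable : (G H : Graph) {n d k : ℕ} →
  ∃[ f ] (IsHomomorphism G (K⁻ n) f × IsLocallyInjective G (K⁻ n) f) →
  Σ (Graph.Incidence H → Fin (d + 2)) (λ c → Graph.IsIncidenceColoring H c × Graph.Adjustable H c) →
  n * 2 + d ≤ k → Graph.IncidenceColorable (G □ H) k
□-colorable G H {n} {d} {k} (f , hom , loc-inj) (c , c-ok , x , y , x≢y , ¬both) size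
  with ρ , ρ-injective , ρx , ρy ← isolate₂ (ℕ.+-comm d 2) x y x≢y
  = isArcColoring⇒colorable (G □ H) {ι = λ z → inject≤ (flatten z) size}
      (□-color-isArcColoring G H hom loc-inj κ-ok {free} (λ {v} → free-ok v))
      (λ eq → flatten-injective (Fin.inject≤-injective size size _ _ eq))
  where
  module H = Graph H

  κ : ∀ v w → v H.~ w → Fin 2 ⊎ Fin d
  κ _ _ e = ρ (c (arc H e))

  κ-ok : IsArcColoring H κ
  κ-ok = record
    { out     = λ e e′ v≢w → IsArcColoring.out c-arcs e e′ v≢w ∘ ρ-injective
    ; through = λ e e′ → IsArcColoring.through c-arcs e e′ ∘ ρ-injective
    }
    where c-arcs = isIncidenceColoring⇒isArcColoring H c-ok

  missing : ∀ v → Σ (Fin 2) λ a → ∀ {w} e → κ v w e ≢ inj₁ a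
  missing v with ∈S⁰? H x c v
  ... | no x∉  = zero , λ e eq → x∉ (arc H e , refl , ρ-injective (trans eq (sym ρx)))
  ... | yes x∈ = suc zero , λ e eq → ¬both v (x∈ , arc H e , refl , ρ-injective (trans eq (sym ρy)))

  free : H.V → Fin 2
  free v = proj₁ (missing v)

  free-ok : ∀ v {w} e → κ v w e ≢ inj₁ (free v)
  free-ok v = proj₂ (missing v)

-- Serves the case of an empty factor, where the product has maximum degree 0 and the sum of the
-- maximum degrees may exceed it.
empty⇒colorable : (G : Graph) → ¬ Graph.V G → ∀ k → Graph.IncidenceColorable G k
empty⇒colorable G empty k = (λ i → ⊥-elim (empty (vertex i))) , λ i → ⊥-elim (empty (vertex i))
  where open Graph G

-- Here `a`, `b` and `m` stand for the maximum degrees of `G`, `H` and `G □ H`: the `2 * n` vertices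
-- of `K⁻ n` and the `b` ordinary colors of `H` fit into the allowed palette.
palette-size : ∀ n {a b m} → a + 2 ≡ 2 * n → a + b ≤ m → n * 2 + b ≤ m + 2
palette-size n {a} {b} {m} a+2≡2n a+b≤m = begin
  n * 2 + b    ≡⟨ cong (_+ b) (trans (ℕ.*-comm n 2) (sym a+2≡2n)) ⟩
  (a + 2) + b  ≡⟨ ℕ.+-assoc a 2 b ⟩
  a + (2 + b)  ≡⟨ cong (a +_) (ℕ.+-comm 2 b) ⟩
  a + (b + 2)  ≡⟨ ℕ.+-assoc a b 2 ⟨
  (a + b) + 2  ≤⟨ ℕ.+-monoˡ-≤ 2 a+b≤m ⟩
  m + 2        ∎
  where open ℕ.≤-Reasoning

mainTheorem12 : (G H : Graph) → Sub2Permutable G → TwoAdjustable H →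
    χᵢ (G □ H) ≤ Graph.Δ (G □ H) + 2
mainTheorem12 G H (n , Δ+2≡2n , homᴳ) colᴴ = χᵢ-least (G □ H) _ (colorable (inhabited? G) (inhabited? H))
  where
  colorable : Dec (Graph.V G) → Dec (Graph.V H) → Graph.IncidenceColorable (G □ H) (Graph.Δ (G □ H) + 2)
  colorable (yes u) (yes v) = □-colorable G H {n} homᴳ colᴴ (palette-size n Δ+2≡2n (Δ-□ G H u v))
  colorable (no ¬u) _       = empty⇒colorable (G □ H) (¬u ∘ proj₁) _
  colorable _       (no ¬v) = empty⇒colorable (G □ H) (¬v ∘ proj₂) _
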